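{- (1) For every integer $n\ge 1$, the Queen graph $Q_n$ of size $n$ satisfies $\alpha_{\mathrm{od}}(Q_n)=1$. (2) Consequently, for every integer $n\geq 1$, $\chi_{\mathrm{so}}(Q_n)=n^2$. (3) Moreover, every odd independent set of the infinite Queen graph, on the board $\mathbb{N}\times\mathbb{N}$ as well as on the board $\mathbb{Z}\times\mathbb{Z}$, is empty, a singleton, or infinite.
   Context: Here $\mathbb{N}=\{1,2,3,\ldots\}$. The Queen graph on a board $B\subseteq\mathbb{Z}\times\mathbb{Z}$ has vertex set $B$, and two distinct vertices $(a,b),(a',b')$ are adjacent iff $a=a'$, or $b=b'$, or $a-a'=b-b'$, or $a-a'=b'-b$. The Queen graph $Q_n$ of size $n$ is the one on $\{1,\ldots,n\}\times\{1,\ldots,n\}$; the infinite Queen graph is the one on $\mathbb{N}\times\mathbb{N}$ or on $\mathbb{Z}\times\mathbb{Z}$. For a graph $G=(V,E)$, $N(v)$ denotes the open neighborhood of $v$. A set $S\subseteq V$ is an odd independent set if it is independent and, for every vertex $v\in V\setminus S$, the set $N(v)\cap S$ is empty or of odd size. The odd independence number $\alpha_{\mathrm{od}}(G)$ is the largest size of an odd independent set of $G$. A proper vertex coloring of $G$ is a strong odd coloring if, for every vertex $v$, each color occurring in $N(v)$ occurs on an odd number of vertices of $N(v)$. The strong odd chromatic number $\chi_{\mathrm{so}}(G)$ is the least number of colors in a strong odd coloring of $G$. -}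

module Defs where

open import Level using (Level; 0ℓ)
open import Data.Fin using (Fin)
open import Data.Integer as ℤ using (ℤ; +_; 1ℤ)
import Data.Integer.Properties as ℤ
open import Data.List using (List; length)
open import Data.List.Membership.Propositional using () renaming (_∈_ to _∈ₗ_)
open import Data.List.Relation.Unary.Unique.Propositional using (Unique)
open import Data.Nat using (ℕ; _≤_)
open import Data.Nat.Divisibility using (_∣_)
open import Data.Product using (_×_; _,_; ∃-syntax; Σ-syntax)
open import Data.Refinement using (Refinement; value)
open import Data.Sum using (_⊎_; inj₁; inj₂)
open import Function.Base using (_∘_)
open import Function.Bundles using (_⇔_)
open import Relation.Binary.Core using (Rel)
open import Relation.Binary.Definitions using (Symmetric; Irreflexive)
open import Relation.Binary.PropositionalEquality
  using (_≡_; _≢_; refl; sym; cong; module ≡-Reasoning)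
open import Relation.Nullary using (¬_)
open import Relation.Unary using (Pred; _∈_; _∉_; _∩_; _≐_; ｛_｝; Empty; Satisfiable; U)
open import Algebra.Properties.AbelianGroup ℤ.+-0-abelianGroup using (⁻¹-anti-homo‿-)

private
  variable
    ℓ : Level
    A : Set

HasSize : Pred A 0ℓ → ℕ → Set
HasSize {A} P k =
  Σ[ xs ∈ List A ] Unique xs × (∀ x → x ∈ₗ xs ⇔ x ∈ P) × length xs ≡ k

Finite : Pred A 0ℓ → Set
Finite P = ∃[ k ] HasSize P k

Infinite : Pred A 0ℓ → Set
Infinite P = ¬ Finite P

HasOddSize : Pred A 0ℓ → Set
HasOddSize P = ∃[ k ] HasSize P k × ¬ (2 ∣ k)

Singleton : Pred A 0ℓ → Set
Singleton P = ∃[ x ] P ≐ ｛ x ｝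

IsGreatest : Pred ℕ ℓ → Pred ℕ ℓ
IsGreatest P k = P k × (∀ m → P m → m ≤ k)

IsLeast : Pred ℕ ℓ → Pred ℕ ℓ
IsLeast P k = P k × (∀ m → P m → k ≤ m)

record Graph : Set₁ where
  field
    Vertex   : Set
    _~_      : Rel Vertex 0ℓ
    ~-sym    : Symmetric _~_
    ~-irrefl : Irreflexive _≡_ _~_

module _ (G : Graph) where
  open Graph G

  N : Vertex → Pred Vertex 0ℓ
  N v u = v ~ u

  IsIndependent : Pred Vertex 0ℓ → Set
  IsIndependent S = ∀ u v → u ∈ S → v ∈ S → ¬ (u ~ v)

  IsOddIndependent : Pred Vertex 0ℓ → Set
  IsOddIndependent S =
    IsIndependent S ×
    (∀ v → v ∉ S → Empty (N v ∩ S) ⊎ HasOddSize (N v ∩ S))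

  HasOddIndependentSetOfSize : ℕ → Set₁
  HasOddIndependentSetOfSize k = ∃[ S ] IsOddIndependent S × HasSize S k

  -- α_od(G) = k, as a relation, since a general graph need not have a largest
  -- finite odd independent set.
  OddIndependenceNumber : ℕ → Set₁
  OddIndependenceNumber = IsGreatest HasOddIndependentSetOfSize

  ColorClass : ∀ {k} → (Vertex → Fin k) → Fin k → Pred Vertex 0ℓ
  ColorClass φ c v = φ v ≡ c

  IsProper : ∀ {k} → (Vertex → Fin k) → Set
  IsProper φ = ∀ u v → u ~ v → φ u ≢ φ v

  IsStrongOddColoring : ∀ {k} → (Vertex → Fin k) → Set
  IsStrongOddColoring φ =
    IsProper φ ×
    (∀ v c → Satisfiable (N v ∩ ColorClass φ c) → HasOddSize (N v ∩ ColorClass φ c))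

  -- A colouring into Fin k may leave colours unused; this does not affect the
  -- least k.
  HasStrongOddColoring : ℕ → Set
  HasStrongOddColoring k = Σ[ φ ∈ (Vertex → Fin k) ] IsStrongOddColoring φ

  -- χ_so(G) = k.
  StrongOddChromaticNumber : ℕ → Set
  StrongOddChromaticNumber = IsLeast HasStrongOddColoring

Attacks : Rel (ℤ × ℤ) 0ℓ
Attacks (a , b) (a′ , b′) =
  a ≡ a′ ⊎ b ≡ b′ ⊎ a ℤ.- a′ ≡ b ℤ.- b′ ⊎ a ℤ.- a′ ≡ b′ ℤ.- b

private
  flip-diff : ∀ a a′ b b′ → a ℤ.- a′ ≡ b ℤ.- b′ → a′ ℤ.- a ≡ b′ ℤ.- b
  flip-diff a a′ b b′ eq = begin
    a′ ℤ.- a          ≡⟨ ⁻¹-anti-homo‿- a a′ ⟨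
    ℤ.- (a ℤ.- a′)    ≡⟨ cong ℤ.-_ eq ⟩
    ℤ.- (b ℤ.- b′)    ≡⟨ ⁻¹-anti-homo‿- b b′ ⟩
    b′ ℤ.- b          ∎
    where open ≡-Reasoning

Attacks-sym : Symmetric Attacks
Attacks-sym (inj₁ eq)               = inj₁ (sym eq)
Attacks-sym (inj₂ (inj₁ eq))        = inj₂ (inj₁ (sym eq))
Attacks-sym {a , b} {a′ , b′} (inj₂ (inj₂ (inj₁ eq))) =
  inj₂ (inj₂ (inj₁ (flip-diff a a′ b b′ eq)))
Attacks-sym {a , b} {a′ , b′} (inj₂ (inj₂ (inj₂ eq))) =
  inj₂ (inj₂ (inj₂ (flip-diff a a′ b′ b eq)))

-- Membership of the board is proof-irrelevant in Refinement, so vertices are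
-- equal exactly when their coordinates are.
Queen : Pred (ℤ × ℤ) 0ℓ → Graph
Queen B = record
  { Vertex   = Refinement (ℤ × ℤ) B
  ; _~_      = λ u v → u ≢ v × Attacks (value u) (value v)
  ; ~-sym    = λ { (u≢v , att) → u≢v ∘ sym , Attacks-sym att }
  ; ~-irrefl = λ { u≡v (u≢v , _) → u≢v u≡v }
  }

square : ℕ → Pred (ℤ × ℤ) 0ℓ
square n (a , b) = (1ℤ ℤ.≤ a × a ℤ.≤ + n) × (1ℤ ℤ.≤ b × b ℤ.≤ + n)

-- ℕ = {1, 2, 3, …} here.
ℕ×ℕ : Pred (ℤ × ℤ) 0ℓ
ℕ×ℕ (a , b) = 1ℤ ℤ.≤ a × 1ℤ ℤ.≤ b

ℤ×ℤ : Pred (ℤ × ℤ) 0ℓ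
ℤ×ℤ = U

{-# OPTIONS --safe #-}

-- Let S be a finite odd independent set on a board containing (a, b′) along with (a, b) and (a′, b′).
-- A cell (x p, y q) with p ≠ q in S lies outside S and is attacked by both p and q, hence by a third
-- queen of S, necessarily along a diagonal. Consider the bounding box of S. On each of its sides,
-- every queen projects to a cell that some queen hits diagonally, and the queen on that side
-- contributes two diagonal hits at its own cell; so for every weight w ≥ 0 on the side the weights of
-- the projections, plus that of the queen on the side, sum to at most the weights of the diagonal hits.
-- Constant weights on two opposite sides show that the box is a square. Suitable linear weights on
-- three sides show that the top and the right queen lie on a common antidiagonal, so they coincide
-- and sit in the corner. By reflection the top queen sits in the top left corner as well, and |S| = 1.

module Submission where

open import Defs
open import Level using (0ℓ)
open import Axiom.ExcludedMiddle using (ExcludedMiddle)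
import Algebra.Properties.AbelianGroup as AbelianGroup
open import Data.Empty using (⊥-elim-irr)
open import Data.Fin as Fin using (Fin; toℕ; fromℕ<; combine; remQuot)
open import Data.Fin.Properties
  using (toℕ<n; toℕ-injective; toℕ-fromℕ<; combine-remQuot; remQuot-combine; injective⇒≤)
open import Data.Integer as ℤ using (ℤ; +_; -[1+_])
import Data.Integer.Properties as ℤ
import Data.Integer.Tactic.RingSolver as ℤ-Solver
open import Data.Irrelevant as Irrelevant using ([_])
open import Data.List using (List; []; _∷_; _++_; map; length; filter; allFin)
import Data.List.Extrema ℤ.≤-totalOrder as Extrema
open import Data.List.Membership.Propositional using (find; lose) renaming (_∈_ to _∈ₗ_)
open import Data.List.Membership.Propositional.Properties
  using (∈-∃++; ∈-++⁺ˡ; ∈-++⁺ʳ; ∈-map⁺; ∈-allFin; ∈-filter⁺; ∈-filter⁻)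
open import Data.List.Properties using (map-++; map-∘)
open import Data.List.Relation.Binary.Permutation.Propositional using (_↭_; ↭⇒↭ₛ; ↭-sym)
open import Data.List.Relation.Binary.Permutation.Propositional.Properties as ↭
  using (shift; ∈-resp-↭)
import Data.List.Relation.Binary.Permutation.Setoid.Properties as ↭ₛ
open import Data.List.Relation.Unary.All as All using (All; []; _∷_)
import Data.List.Relation.Unary.All.Properties as All
open import Data.List.Relation.Unary.AllPairs using ([]; _∷_)
open import Data.List.Relation.Unary.Any using (here; there; any?; satisfied)
open import Data.List.Relation.Unary.Any.Properties using (¬Any[])
open import Data.List.Relation.Unary.Unique.Propositional using (Unique)
import Data.List.Relation.Unary.Unique.Propositional.Properties as Unique
open import Data.Nat as ℕ using (ℕ; zero; suc; _+_; _*_; _∸_; _≤_; _<_; _^_; z≤n; s≤s)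
open import Data.Nat.Divisibility using (_∣_; ∣-refl; ∣1⇒≡1)
open import Data.Nat.ListAction using (sum)
open import Data.Nat.ListAction.Properties using (sum-++; sum-↭)
open import Data.Nat.Properties as ℕ
  using (≤-refl; ≤-trans; ≤-reflexive; module ≤-Reasoning)
import Data.Nat.Tactic.RingSolver as ℕ-Solver
open import Data.Product using (_×_; _,_; ∃-syntax; proj₁; proj₂; uncurry)
open import Data.Product.Properties using (≡-dec)
open import Data.Refinement as Refinement using (_,_; value; proof; value-injective)
open import Data.Sum using (_⊎_; inj₁; inj₂; [_,_])
open import Function.Base using (_∘_; const; case_of_)
open import Function.Bundles using (Equivalence; mk⇔)
open import Relation.Binary.Definitions using (DecidableEquality) renaming (Decidable to Decidable₂)
open import Relation.Binary.PropositionalEquality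
  using (_≡_; _≢_; refl; sym; trans; cong; cong₂; subst; setoid; module ≡-Reasoning)
open import Relation.Nullary using (¬_; yes; no; contradiction)
open import Relation.Nullary.Decidable using (¬?; _×-dec_; _⊎-dec_)
open import Relation.Unary using (Pred; Empty; Satisfiable; _∩_; _∉_; ｛_｝)
  renaming (Decidable to Decidable₁)

private
  module ℤ-Group = AbelianGroup ℤ.+-0-abelianGroup

  variable
    A : Set

-- Sums of natural weights over lists.

∑ : List A → (A → ℕ) → ℕ
∑ xs f = sum (map f xs)

∑-mono : ∀ (xs : List A) {f g : A → ℕ} → (∀ {x} → x ∈ₗ xs → f x ≤ g x) → ∑ xs f ≤ ∑ xs g
∑-mono []       f≤g = z≤n
∑-mono (x ∷ xs) f≤g = ℕ.+-mono-≤ (f≤g (here refl)) (∑-mono xs (f≤g ∘ there))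

∑-+ : ∀ (xs : List A) (f g : A → ℕ) → ∑ xs (λ x → f x + g x) ≡ ∑ xs f + ∑ xs g
∑-+ []       f g = refl
∑-+ (x ∷ xs) f g = begin
  (f x + g x) + ∑ xs (λ y → f y + g y)  ≡⟨ cong₂ _+_ {f x + g x} refl (∑-+ xs f g) ⟩
  (f x + g x) + (∑ xs f + ∑ xs g)       ≡⟨ interchange (f x) (g x) (∑ xs f) (∑ xs g) ⟩
  (f x + ∑ xs f) + (g x + ∑ xs g)       ∎
  where
  open ≡-Reasoning
  interchange : ∀ a b c d → (a + b) + (c + d) ≡ (a + c) + (b + d)
  interchange = ℕ-Solver.solve-∀

∑-const : ∀ (xs : List A) c → ∑ xs (const c) ≡ length xs * c
∑-const []       c = refl
∑-const (x ∷ xs) c = cong₂ _+_ {c} refl (∑-const xs c)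

extract : ∀ {x : A} {xs} → x ∈ₗ xs → ∃[ ys ] xs ↭ x ∷ ys
extract {x = x} x∈xs with ys , zs , refl ← ∈-∃++ x∈xs = ys ++ zs , shift x ys zs

-- Induction on `xs`: one copy of the head `x` is removed from `ys`, and the tail still embeds in
-- the remainder because `x` does not recur in it. The list `ys` may have repetitions.
∑-mono-⊆ : ∀ (w : A → ℕ) {xs ys} → Unique xs → (∀ {x} → x ∈ₗ xs → x ∈ₗ ys) → ∑ xs w ≤ ∑ ys w
∑-mono-⊆ w {[]}     _             xs⊆ys = z≤n
∑-mono-⊆ w {x ∷ xs} (x∉xs ∷ xs!) xs⊆ys with zs , ys↭x∷zs ← extract (xs⊆ys (here refl)) =
  ≤-trans (ℕ.+-monoʳ-≤ (w x) (∑-mono-⊆ w xs! xs⊆zs))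
          (≤-reflexive (sym (sum-↭ (↭.map⁺ w ys↭x∷zs))))
  where
  xs⊆zs : ∀ {y} → y ∈ₗ xs → y ∈ₗ zs
  xs⊆zs y∈xs with ∈-resp-↭ ys↭x∷zs (xs⊆ys (there y∈xs))
  ... | here refl  = contradiction refl (All.lookup x∉xs y∈xs)
  ... | there y∈zs = y∈zs

unique-map : ∀ {B : Set} {f : A → B} {xs} →
  (∀ {x y} → x ∈ₗ xs → y ∈ₗ xs → f x ≡ f y → x ≡ y) → Unique xs → Unique (map f xs)
unique-map f-inj []           = []
unique-map f-inj (x∉xs ∷ xs!) =
  All.map⁺ (All.tabulate λ y∈xs fx≡fy →
    All.lookup x∉xs y∈xs (f-inj (here refl) (there y∈xs) fx≡fy))
  ∷ unique-map (λ x∈xs y∈xs → f-inj (there x∈xs) (there y∈xs)) xs!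

-- Counting diagonal hits along a line.

-- A simultaneous choice of one hit per position. The equality of the mapped lists lets both
-- distinctness and weighted sums pass from the positions to the chosen hits.
preimages : ∀ {B C : Set} {f : A → C} {pos : B → C} {xs hs} →
  All (λ x → ∃[ u ] u ∈ₗ hs × pos u ≡ f x) xs →
  ∃[ us ] All (_∈ₗ hs) us × map pos us ≡ map f xs
preimages []                           = [] , [] , refl
preimages ((u , u∈hs , eq) ∷ rest) with us , us⊆hs , eqs ← preimages rest =
  u ∷ us , u∈hs ∷ us⊆hs , cong₂ _∷_ eq eqs

-- Along the row or column of t every position f q carries a diagonal hit (by g or h), and the
-- position of t itself carries the two of t.
line-inequality : ∀ {C : Set} {f g h : A → C} {t qs} → Unique (map f qs) → t ∈ₗ qs →
  g t ≡ f t → h t ≡ f t →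
  (∀ {q} → q ∈ₗ qs → ∃[ r ] r ∈ₗ qs × (g r ≡ f q ⊎ h r ≡ f q)) →
  ∀ (w : C → ℕ) → ∑ qs (w ∘ f) + w (f t) ≤ ∑ qs (w ∘ g) + ∑ qs (w ∘ h)
line-inequality {A} {C} {f} {g} {h} {t} {qs} fqs! t∈qs gt≡ft ht≡ft hit w
  with rest , qs↭ ← extract t∈qs = begin
  ∑ qs (w ∘ f) + w (f t)                ≡⟨ cong (_+ w (f t)) (sum-↭ (↭.map⁺ (w ∘ f) qs↭)) ⟩
  (w (f t) + ∑ rest (w ∘ f)) + w (f t)  ≡⟨ shuffle (w (f t)) (∑ rest (w ∘ f)) ⟩
  w (f t) + (w (f t) + ∑ rest (w ∘ f))  ≡⟨ cong₂ _+_ (cong w gt≡ft) (cong₂ _+_ (cong w ht≡ft) eq) ⟨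
  ∑ (inj₁ t ∷ inj₂ t ∷ us) (w ∘ pos)    ≤⟨ ∑-mono-⊆ (w ∘ pos) us! us⊆ ⟩
  ∑ hits (w ∘ pos)                      ≡⟨ split ⟩
  ∑ qs (w ∘ g) + ∑ qs (w ∘ h)           ∎
  where
  open ≤-Reasoning
  shuffle : ∀ a b → (a + b) + a ≡ a + (a + b)
  shuffle = ℕ-Solver.solve-∀

  -- Each queen yields two hits, tagged by the diagonal that produces them.
  pos : A ⊎ A → C
  pos = [_,_] g h

  hits : List (A ⊎ A)
  hits = map inj₁ qs ++ map inj₂ qs

  g∈hits : ∀ {r} → r ∈ₗ qs → inj₁ r ∈ₗ hits
  g∈hits = ∈-++⁺ˡ ∘ ∈-map⁺ inj₁

  h∈hits : ∀ {r} → r ∈ₗ qs → inj₂ r ∈ₗ hits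
  h∈hits = ∈-++⁺ʳ (map inj₁ qs) ∘ ∈-map⁺ inj₂

  hit′ : ∀ {q} → q ∈ₗ qs → ∃[ u ] u ∈ₗ hits × pos u ≡ f q
  hit′ q∈qs with hit q∈qs
  ... | r , r∈qs , inj₁ eq = inj₁ r , g∈hits r∈qs , eq
  ... | r , r∈qs , inj₂ eq = inj₂ r , h∈hits r∈qs , eq

  chosen : ∃[ us ] All (_∈ₗ hits) us × map pos us ≡ map f rest
  chosen = preimages (All.tabulate (hit′ ∘ ∈-resp-↭ (↭-sym qs↭) ∘ there))

  us : List (A ⊎ A)
  us = proj₁ chosen

  eqs : map pos us ≡ map f rest
  eqs = proj₂ (proj₂ chosen)

  eq : ∑ us (w ∘ pos) ≡ ∑ rest (w ∘ f)
  eq = cong sum (trans (map-∘ us) (trans (cong (map w) eqs) (sym (map-∘ rest))))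

  fresh : All (f t ≢_) (map pos us) × Unique (map pos us)
  fresh with ft∉ ∷ frest! ← ↭ₛ.Unique-resp-↭ (setoid C) (↭⇒↭ₛ (↭.map⁺ f qs↭)) fqs! =
    subst (All (f t ≢_)) (sym eqs) ft∉ , subst Unique (sym eqs) frest!

  -- The two hits of `t` share the position `f t` but differ in their tags; the chosen hits have
  -- pairwise distinct positions, all different from `f t`.
  us! : Unique (inj₁ t ∷ inj₂ t ∷ us)
  us! = ((λ ()) ∷ All.map (λ ft≢ → λ { refl → ft≢ (sym gt≡ft) }) ft∉us)
      ∷ All.map (λ ft≢ → λ { refl → ft≢ (sym ht≡ft) }) ft∉us
      ∷ Unique.map⁻ (proj₂ fresh)
    where
    ft∉us : All (λ u → f t ≢ pos u) us
    ft∉us = All.map⁻ (proj₁ fresh)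

  us⊆ : ∀ {u} → u ∈ₗ inj₁ t ∷ inj₂ t ∷ us → u ∈ₗ hits
  us⊆ (here refl)            = g∈hits t∈qs
  us⊆ (there (here refl))    = h∈hits t∈qs
  us⊆ (there (there u∈us))   = All.lookup (proj₁ (proj₂ chosen)) u∈us

  split : ∑ hits (w ∘ pos) ≡ ∑ qs (w ∘ g) + ∑ qs (w ∘ h)
  split = trans (cong sum (map-++ (w ∘ pos) (map inj₁ qs) (map inj₂ qs)))
    (trans (sum-++ (map (w ∘ pos) (map inj₁ qs)) _)
           (cong₂ _+_ (cong sum (sym (map-∘ qs))) (cong sum (sym (map-∘ qs)))))

-- Configurations of queens and their symmetries.

-- The cell (x p, y q), attacked by p and q along its column and row, is also attacked along a diagonal.
record Crossing (qs : List A) (x y : A → ℤ) : Set where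
  field
    unique   : Unique qs
    x-inj    : ∀ {p q} → p ∈ₗ qs → q ∈ₗ qs → x p ≡ x q → p ≡ q
    y-inj    : ∀ {p q} → p ∈ₗ qs → q ∈ₗ qs → y p ≡ y q → p ≡ q
    d-inj    : ∀ {p q} → p ∈ₗ qs → q ∈ₗ qs → x p ℤ.- y p ≡ x q ℤ.- y q → p ≡ q
    e-inj    : ∀ {p q} → p ∈ₗ qs → q ∈ₗ qs → x p ℤ.+ y p ≡ x q ℤ.+ y q → p ≡ q
    crossing : ∀ {p q} → p ∈ₗ qs → q ∈ₗ qs → ∃[ r ] r ∈ₗ qs ×
      (x r ℤ.- y r ≡ x p ℤ.- y q ⊎ x r ℤ.+ y r ≡ x p ℤ.+ y q)

module _ {qs : List A} {x y : A → ℤ} where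

  transpose : Crossing qs x y → Crossing qs y x
  transpose K = record
    { unique   = unique
    ; x-inj    = y-inj
    ; y-inj    = x-inj
    ; d-inj    = λ {p} {q} p∈qs q∈qs eq → d-inj p∈qs q∈qs (swap-- (y p) (x p) (y q) (x q) eq)
    ; e-inj    = λ {p} {q} p∈qs q∈qs eq → e-inj p∈qs q∈qs (swap-+ (y p) (x p) (y q) (x q) eq)
    ; crossing = crossing′
    }
    where
    open Crossing K

    swap-- : ∀ a b c d → a ℤ.- b ≡ c ℤ.- d → b ℤ.- a ≡ d ℤ.- c
    swap-- a b c d eq = trans (neg a b) (trans (cong ℤ.-_ eq) (sym (neg c d)))
      where
      neg : ∀ a b → b ℤ.- a ≡ ℤ.- (a ℤ.- b)
      neg = ℤ-Solver.solve-∀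

    swap-+ : ∀ a b c d → a ℤ.+ b ≡ c ℤ.+ d → b ℤ.+ a ≡ d ℤ.+ c
    swap-+ a b c d eq = trans (ℤ.+-comm b a) (trans eq (ℤ.+-comm c d))

    crossing′ : ∀ {p q} → p ∈ₗ qs → q ∈ₗ qs → ∃[ r ] r ∈ₗ qs ×
      (y r ℤ.- x r ≡ y p ℤ.- x q ⊎ y r ℤ.+ x r ≡ y p ℤ.+ x q)
    crossing′ {p} {q} p∈qs q∈qs with crossing q∈qs p∈qs
    ... | r , r∈qs , inj₁ eq = r , r∈qs , inj₁ (swap-- (x r) (y r) (x q) (y p) eq)
    ... | r , r∈qs , inj₂ eq = r , r∈qs , inj₂ (swap-+ (x r) (y r) (x q) (y p) eq)

  -- The equation for `x′` is asked on `qs` only, since the new coordinate will be an absolute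
  -- value, which agrees with the difference just there.
  translate : ∀ {x′ c} → (∀ {q} → q ∈ₗ qs → x′ q ≡ x q ℤ.- c) → Crossing qs x y → Crossing qs x′ y
  translate {x′} {c} x′≡ K = record
    { unique   = unique
    ; x-inj    = λ p∈qs q∈qs eq → x-inj p∈qs q∈qs
        (ℤ-Group.∙-cancelʳ (ℤ.- c) _ _ (trans (sym (x′≡ p∈qs)) (trans eq (x′≡ q∈qs))))
    ; y-inj    = y-inj
    ; d-inj    = λ p∈qs q∈qs eq → d-inj p∈qs q∈qs
        (trans (d-shift p∈qs) (trans (cong (ℤ._+ c) eq) (sym (d-shift q∈qs))))
    ; e-inj    = λ p∈qs q∈qs eq → e-inj p∈qs q∈qs
        (trans (e-shift p∈qs) (trans (cong (ℤ._+ c) eq) (sym (e-shift q∈qs))))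
    ; crossing = crossing′
    }
    where
    open Crossing K

    d-shift : ∀ {p} → p ∈ₗ qs → ∀ {v} → x p ℤ.- v ≡ x′ p ℤ.- v ℤ.+ c
    d-shift p∈qs {v} rewrite x′≡ p∈qs = identity (x _) v c
      where
      identity : ∀ a v c → a ℤ.- v ≡ (a ℤ.- c) ℤ.- v ℤ.+ c
      identity = ℤ-Solver.solve-∀

    e-shift : ∀ {p} → p ∈ₗ qs → ∀ {v} → x p ℤ.+ v ≡ x′ p ℤ.+ v ℤ.+ c
    e-shift p∈qs {v} rewrite x′≡ p∈qs = identity (x _) v c
      where
      identity : ∀ a v c → a ℤ.+ v ≡ (a ℤ.- c) ℤ.+ v ℤ.+ c
      identity = ℤ-Solver.solve-∀

    crossing′ : ∀ {p q} → p ∈ₗ qs → q ∈ₗ qs → ∃[ r ] r ∈ₗ qs ×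
      (x′ r ℤ.- y r ≡ x′ p ℤ.- y q ⊎ x′ r ℤ.+ y r ≡ x′ p ℤ.+ y q)
    crossing′ p∈qs q∈qs with crossing p∈qs q∈qs
    ... | r , r∈qs , inj₁ eq = r , r∈qs , inj₁ (ℤ-Group.∙-cancelʳ c _ _
          (trans (sym (d-shift r∈qs)) (trans eq (d-shift p∈qs))))
    ... | r , r∈qs , inj₂ eq = r , r∈qs , inj₂ (ℤ-Group.∙-cancelʳ c _ _
          (trans (sym (e-shift r∈qs)) (trans eq (e-shift p∈qs))))

  -- A reflection exchanges the two families of diagonals, so `d-inj` and `e-inj` trade places, as
  -- do the two alternatives of `crossing`.
  reflect : ∀ {x′ c} → (∀ {q} → q ∈ₗ qs → x′ q ≡ c ℤ.- x q) → Crossing qs x y → Crossing qs x′ y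
  reflect {x′} {c} x′≡ K = record
    { unique   = unique
    ; x-inj    = λ p∈qs q∈qs eq → x-inj p∈qs q∈qs
        (ℤ.neg-injective (ℤ-Group.∙-cancelˡ c _ _ (trans (sym (x′≡ p∈qs)) (trans eq (x′≡ q∈qs)))))
    ; y-inj    = y-inj
    ; d-inj    = λ p∈qs q∈qs eq → e-inj p∈qs q∈qs
        (trans (e-flip p∈qs) (trans (cong (λ z → c ℤ.- z) eq) (sym (e-flip q∈qs))))
    ; e-inj    = λ p∈qs q∈qs eq → d-inj p∈qs q∈qs
        (trans (d-flip p∈qs) (trans (cong (λ z → c ℤ.- z) eq) (sym (d-flip q∈qs))))
    ; crossing = crossing′
    }
    where
    open Crossing K

    d-flip : ∀ {p} → p ∈ₗ qs → ∀ {v} → x p ℤ.- v ≡ c ℤ.- (x′ p ℤ.+ v)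
    d-flip p∈qs {v} rewrite x′≡ p∈qs = identity (x _) v c
      where
      identity : ∀ a v c → a ℤ.- v ≡ c ℤ.- ((c ℤ.- a) ℤ.+ v)
      identity = ℤ-Solver.solve-∀

    e-flip : ∀ {p} → p ∈ₗ qs → ∀ {v} → x p ℤ.+ v ≡ c ℤ.- (x′ p ℤ.- v)
    e-flip p∈qs {v} rewrite x′≡ p∈qs = identity (x _) v c
      where
      identity : ∀ a v c → a ℤ.+ v ≡ c ℤ.- ((c ℤ.- a) ℤ.- v)
      identity = ℤ-Solver.solve-∀

    cancel : ∀ {a b} → c ℤ.- a ≡ c ℤ.- b → a ≡ b
    cancel = ℤ.neg-injective ∘ ℤ-Group.∙-cancelˡ c _ _

    crossing′ : ∀ {p q} → p ∈ₗ qs → q ∈ₗ qs → ∃[ r ] r ∈ₗ qs ×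
      (x′ r ℤ.- y r ≡ x′ p ℤ.- y q ⊎ x′ r ℤ.+ y r ≡ x′ p ℤ.+ y q)
    crossing′ p∈qs q∈qs with crossing p∈qs q∈qs
    ... | r , r∈qs , inj₁ eq = r , r∈qs , inj₂
          (cancel (trans (sym (d-flip r∈qs)) (trans eq (d-flip p∈qs))))
    ... | r , r∈qs , inj₂ eq = r , r∈qs , inj₁
          (cancel (trans (sym (e-flip r∈qs)) (trans eq (e-flip p∈qs))))

  -- The two diagonals through a queen `q` meet the row at height `c` in `x q - y q + c` and
  -- `x q + y q - c`. Columns are treated by transposing.
  row-inequality : Crossing qs x y → ∀ {t c} → t ∈ₗ qs → y t ≡ c → ∀ w →
    ∑ qs (w ∘ x) + w (x t) ≤
      ∑ qs (λ q → w (x q ℤ.- y q ℤ.+ c)) + ∑ qs (λ q → w (x q ℤ.+ y q ℤ.- c))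
  row-inequality K {t} {c} t∈qs refl = line-inequality (unique-map x-inj unique) t∈qs
    (cancel-+- (x t) c) (cancel--+ (x t) c) hit
    where
    open Crossing K

    cancel-+- : ∀ a b → a ℤ.- b ℤ.+ b ≡ a
    cancel-+- = ℤ-Solver.solve-∀

    cancel--+ : ∀ a b → a ℤ.+ b ℤ.- b ≡ a
    cancel--+ = ℤ-Solver.solve-∀

    hit : ∀ {q} → q ∈ₗ qs → ∃[ r ] r ∈ₗ qs × (x r ℤ.- y r ℤ.+ c ≡ x q ⊎ x r ℤ.+ y r ℤ.- c ≡ x q)
    hit {q} q∈qs with crossing q∈qs t∈qs
    ... | r , r∈qs , inj₁ eq = r , r∈qs , inj₁ (trans (cong (ℤ._+ c) eq) (cancel-+- (x q) c))
    ... | r , r∈qs , inj₂ eq = r , r∈qs , inj₂ (trans (cong (λ z → z ℤ.- c) eq) (cancel--+ (x q) c))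

-- Weights on the sides of a box.

-- A weight supported on a side of length `m`: a diagonal that meets the extended side outside the
-- box contributes 0.
window : ℕ → (ℕ → ℕ) → ℤ → ℕ
window m w (+ n) with n ℕ.≤? m
... | yes _ = w n
... | no  _ = 0
window m w -[1+ n ] = 0

window-in : ∀ {m n} w → n ≤ m → window m w (+ n) ≡ w n
window-in {m} {n} w n≤m with n ℕ.≤? m
... | yes _   = refl
... | no  n≰m = contradiction n≤m n≰m

window-out : ∀ {m n} w → m < n → window m w (+ n) ≡ 0
window-out {m} {n} w m<n with n ℕ.≤? m
... | yes n≤m = contradiction n≤m (ℕ.<⇒≱ m<n)
... | no  _   = refl

window-≤ : ∀ {m} w n → window m w (+ n) ≤ w n
window-≤ {m} w n with n ℕ.≤? m
... | yes _ = ≤-refl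
... | no  _ = z≤n

spike : ℕ → ℤ → ℕ
spike m (+ zero)  = m
spike m (+ suc _) = 0
spike m -[1+ _ ]  = 0

spike-≢0 : ∀ m {z} → + 0 ≢ z → spike m z ≡ 0
spike-≢0 m {+ zero}   0≢0 = contradiction refl 0≢0
spike-≢0 m {+ suc _}  _   = refl
spike-≢0 m { -[1+ _ ]} _   = refl

-- At most one entry has `f x` equal to 0. This will bound the excess caused by queens on a main
-- diagonal.
∑-spike : ∀ m {f : A → ℤ} {xs} → Unique (map f xs) → ∑ xs (spike m ∘ f) ≤ m
∑-spike m {f} {[]}     _             = z≤n
∑-spike m {f} {x ∷ xs} (fx∉ ∷ fxs!) with f x
... | + suc _  = ∑-spike m fxs!
... | -[1+ _ ] = ∑-spike m fxs!
... | + zero   = begin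
  m + ∑ xs (spike m ∘ f)  ≤⟨ ℕ.+-monoʳ-≤ m (∑-mono xs λ x∈xs →
                               ≤-reflexive (spike-≢0 m (All.lookup (All.map⁻ fx∉) x∈xs))) ⟩
  m + ∑ xs (const 0)      ≡⟨ cong₂ _+_ {m} refl (trans (∑-const xs 0) (ℕ.*-zeroʳ (length xs))) ⟩
  m + 0                   ≡⟨ ℕ.+-identityʳ m ⟩
  m                       ∎
  where open ≤-Reasoning

-- The bounding box is a square.

-- The box has its lower left corner at the origin. `l`, `r`, `b`, `t` are queens on its left,
-- right, bottom and top sides, and some of them may coincide.
record Boxed (qs : List A) (X Y : A → ℕ) (l r b t : A) (W H : ℕ) : Set where
  field
    queens : Crossing qs (+_ ∘ X) (+_ ∘ Y)
    l∈qs   : l ∈ₗ qs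
    r∈qs   : r ∈ₗ qs
    b∈qs   : b ∈ₗ qs
    t∈qs   : t ∈ₗ qs
    Xl≡0   : X l ≡ 0
    Xr≡W   : X r ≡ W
    Yb≡0   : Y b ≡ 0
    Yt≡H   : Y t ≡ H
    X≤W    : ∀ {q} → q ∈ₗ qs → X q ≤ W
    Y≤H    : ∀ {q} → q ∈ₗ qs → Y q ≤ H

module _ {qs : List A} {X Y : A → ℕ} {l r b t : A} {W H : ℕ} where

  Boxed-transpose : Boxed qs X Y l r b t W H → Boxed qs Y X b t l r H W
  Boxed-transpose B = record
    { queens = transpose queens
    ; l∈qs = b∈qs ; r∈qs = t∈qs ; b∈qs = l∈qs ; t∈qs = r∈qs
    ; Xl≡0 = Yb≡0 ; Xr≡W = Yt≡H ; Yb≡0 = Xl≡0 ; Yt≡H = Xr≡W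
    ; X≤W  = Y≤H  ; Y≤H  = X≤W
    }
    where open Boxed B

  Boxed-reflect : Boxed qs X Y l r b t W H → Boxed qs (λ q → W ∸ X q) Y r l b t W H
  Boxed-reflect B = record
    { queens = reflect {c = + W}
        (λ {q} q∈qs → sym (trans (ℤ.m-n≡m⊖n W (X q)) (ℤ.⊖-≥ (X≤W q∈qs)))) queens
    ; l∈qs = r∈qs ; r∈qs = l∈qs ; b∈qs = b∈qs ; t∈qs = t∈qs
    ; Xl≡0 = trans (cong (W ∸_) Xr≡W) (ℕ.n∸n≡0 W)
    ; Xr≡W = cong (W ∸_) Xl≡0
    ; Yb≡0 = Yb≡0 ; Yt≡H = Yt≡H
    ; X≤W  = λ {q} _ → ℕ.m∸n≤m W (X q) ; Y≤H = Y≤H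
    }
    where open Boxed B

  -- In a box wider than high a diagonal meets at most one of the two vertical sides. So the
  -- 2 |qs| diagonal lines yield at most 2 |qs| hits there, while 2 (|qs| + 1) are needed.
  width≤height : Boxed qs X Y l r b t W H → W ≤ H
  width≤height B = ℕ.≮⇒≥ λ H<W → ℕ.<⇒≱ (ℕ.+-mono-< (ℕ.n<1+n n) (ℕ.n<1+n n)) (begin
    suc n + suc n
      ≤⟨ ℕ.+-mono-≤ (side r∈qs) (side l∈qs) ⟩
    (∑ qs (w ∘ +_ ∘ Y) + w (+ Y r)) + (∑ qs (w ∘ +_ ∘ Y) + w (+ Y l))
      ≤⟨ ℕ.+-mono-≤ (row-inequality queensᵀ r∈qs (cong +_ Xr≡W) w)
                    (row-inequality queensᵀ l∈qs (cong +_ Xl≡0) w) ⟩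
    (∑ qs R₁ + ∑ qs R₂) + (∑ qs L₁ + ∑ qs L₂)
      -- The hits are regrouped by diagonal: each queen has two, and each of these meets both
      -- vertical sides once when they are extended.
      ≡⟨ interchange (∑ qs R₁) (∑ qs R₂) (∑ qs L₁) (∑ qs L₂) ⟩
    (∑ qs L₁ + ∑ qs R₁) + (∑ qs R₂ + ∑ qs L₂)
      ≡⟨ cong₂ _+_ (∑-+ qs L₁ R₁) (∑-+ qs R₂ L₂) ⟨
    ∑ qs (λ q → L₁ q + R₁ q) + ∑ qs (λ q → R₂ q + L₂ q)
      ≤⟨ ℕ.+-mono-≤ (∑-mono qs λ {q} _ → d-hits H<W q) (∑-mono qs λ {q} _ → e-hits H<W q) ⟩
    ∑ qs (const 1) + ∑ qs (const 1)
      ≡⟨ cong₂ _+_ ∑1≡n ∑1≡n ⟩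
    n + n ∎)
    where
    open Boxed B
    open ≤-Reasoning

    queensᵀ : Crossing qs (+_ ∘ Y) (+_ ∘ X)
    queensᵀ = transpose queens

    n : ℕ
    n = length qs

    w : ℤ → ℕ
    w = window H (const 1)

    R₁ R₂ L₁ L₂ : A → ℕ
    R₁ q = w (+ Y q ℤ.- + X q ℤ.+ + W)
    R₂ q = w (+ Y q ℤ.+ + X q ℤ.- + W)
    L₁ q = w (+ Y q ℤ.- + X q ℤ.+ + 0)
    L₂ q = w (+ Y q ℤ.+ + X q ℤ.- + 0)

    ∑1≡n : ∑ qs (const 1) ≡ n
    ∑1≡n = trans (∑-const qs 1) (ℕ.*-identityʳ n)

    side : ∀ {q} → q ∈ₗ qs → suc n ≤ ∑ qs (w ∘ +_ ∘ Y) + w (+ Y q)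
    side {q} q∈qs = begin
      suc n                              ≡⟨ ℕ.+-comm n 1 ⟨
      n + 1                              ≡⟨ cong₂ _+_ ∑1≡n refl ⟨
      ∑ qs (const 1) + 1                 ≤⟨ ℕ.+-mono-≤ (∑-mono qs in-window) (in-window q∈qs) ⟩
      ∑ qs (w ∘ +_ ∘ Y) + w (+ Y q)      ∎
      where
      in-window : ∀ {q} → q ∈ₗ qs → 1 ≤ w (+ Y q)
      in-window q∈qs = ≤-reflexive (sym (window-in (const 1) (Y≤H q∈qs)))

    interchange : ∀ a b c d → (a + b) + (c + d) ≡ (c + a) + (b + d)
    interchange = ℕ-Solver.solve-∀

    -- A diagonal meets the two vertical sides at heights `z` and `z + W`. If `z` is nonnegative,
    -- the second exceeds `H`; otherwise the first is below the box.
    one-side : H < W → ∀ z → w z + w (z ℤ.+ + W) ≤ 1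
    one-side H<W (+ k) = begin
      w (+ k) + w (+ (k + W))  ≤⟨ ℕ.+-mono-≤ (window-≤ {H} (const 1) k)
        (≤-reflexive (window-out (const 1) (ℕ.<-≤-trans H<W (ℕ.m≤n+m W k)))) ⟩
      1 + 0                    ≡⟨⟩
      1                        ∎
    one-side H<W -[1+ k ] = window-≤1 (-[1+ k ] ℤ.+ + W)
      where
      window-≤1 : ∀ z → w z ≤ 1
      window-≤1 (+ k)    = window-≤ {H} (const 1) k
      window-≤1 -[1+ k ] = z≤n

    d-hits : H < W → ∀ q → L₁ q + R₁ q ≤ 1
    d-hits H<W q = subst (λ z → w z + R₁ q ≤ 1) (sym (ℤ.+-identityʳ (+ Y q ℤ.- + X q)))
      (one-side H<W (+ Y q ℤ.- + X q))

    e-hits : H < W → ∀ q → R₂ q + L₂ q ≤ 1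
    e-hits H<W q = subst (λ z → R₂ q + w z ≤ 1) (cancel (+ Y q ℤ.+ + X q) (+ W))
      (one-side H<W (+ Y q ℤ.+ + X q ℤ.- + W))
      where
      cancel : ∀ a b → a ℤ.- b ℤ.+ b ≡ a ℤ.- + 0
      cancel = ℤ-Solver.solve-∀

-- Linear weights on three sides of a square.

-- Weight z on the top side of the square, m ∸ z on the right side and m on the bottom side make
-- the weights of the hits of each queen balance, except for queens on a main diagonal.
module _ {qs : List A} {X Y : A → ℕ} {l r b t : A} {m : ℕ} where

  top≤right : Boxed qs X Y l r b t m m → X t ≤ Y r
  -- Adding the inequalities for the three sides and cancelling the projection sums leaves
  -- `X t + (m ∸ Y r) + m ≤ m + m`. The two `m` on the right come from the spikes, one for each main
  -- diagonal.
  top≤right B = subst (X t ≤_) (ℕ.m∸[m∸n]≡n (Y≤H r∈qs)) (ℕ.m+n≤o⇒m≤o∸n (X t)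
    (ℕ.+-cancelʳ-≤ m _ m (ℕ.+-cancelˡ-≤ (∑ qs C + ∑ qs (const m)) _ _ (begin
      (∑ qs C + ∑ qs (const m)) + (X t + (m ∸ Y r) + m)
        ≡⟨ cong (λ s → (s + ∑ qs (const m)) + (X t + (m ∸ Y r) + m)) (∑-+ qs X (λ q → m ∸ Y q)) ⟩
      (∑ qs X + ∑ qs (λ q → m ∸ Y q) + ∑ qs (const m)) + (X t + (m ∸ Y r) + m)
        ≡⟨ regroup (∑ qs X) (∑ qs (λ q → m ∸ Y q)) (∑ qs (const m)) (X t) (m ∸ Y r) m ⟩
      (∑ qs X + X t) + (∑ qs (λ q → m ∸ Y q) + (m ∸ Y r)) + (∑ qs (const m) + m)
        ≤⟨ ℕ.+-mono-≤ (ℕ.+-mono-≤ top right) bottom ⟩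
      (∑ qs T₁ + ∑ qs T₂) + (∑ qs R₁ + ∑ qs R₂) + (∑ qs B₁ + ∑ qs B₂)
        ≡⟨ regroup′ (∑ qs T₁) (∑ qs T₂) (∑ qs R₁) (∑ qs R₂) (∑ qs B₁) (∑ qs B₂) ⟩
      (∑ qs T₁ + ∑ qs R₁ + ∑ qs B₁) + (∑ qs T₂ + ∑ qs R₂ + ∑ qs B₂)
        ≡⟨ cong₂ _+_ (∑-+₃ T₁ R₁ B₁) (∑-+₃ T₂ R₂ B₂) ⟨
      ∑ qs (λ q → T₁ q + R₁ q + B₁ q) + ∑ qs (λ q → T₂ q + R₂ q + B₂ q)
        ≤⟨ ℕ.+-mono-≤ (∑-mono qs d-hits) (∑-mono qs λ {q} _ → e-hits q) ⟩
      ∑ qs (λ q → C q + spike m (d q)) + ∑ qs (λ q → m + spike m (e q))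
        ≡⟨ cong₂ _+_ (∑-+ qs C (spike m ∘ d)) (∑-+ qs (const m) (spike m ∘ e)) ⟩
      (∑ qs C + ∑ qs (spike m ∘ d)) + (∑ qs (const m) + ∑ qs (spike m ∘ e))
        ≤⟨ ℕ.+-mono-≤ (ℕ.+-monoʳ-≤ (∑ qs C) (∑-spike m d-unique))
                      (ℕ.+-monoʳ-≤ (∑ qs (const m)) (∑-spike m e-unique)) ⟩
      (∑ qs C + m) + (∑ qs (const m) + m)
        ≡⟨ interchange (∑ qs C) (∑ qs (const m)) m ⟩
      (∑ qs C + ∑ qs (const m)) + (m + m) ∎))))
    where
    open Boxed B
    open Crossing queens
    open ≤-Reasoning

    τ ρ β : ℤ → ℕ
    τ z = window m (λ k → k) z
    ρ z = τ (+ m ℤ.- z)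
    β z = window m (const m) z

    d e : A → ℤ
    d q = + X q ℤ.- + Y q
    e q = + X q ℤ.+ + Y q ℤ.- + m

    C T₁ T₂ R₁ R₂ B₁ B₂ : A → ℕ
    -- `C q` is the weight of the projections of `q` to the top and right sides, and also the point
    -- where its difference diagonal meets the line of the top side.
    C  q = X q + (m ∸ Y q)
    T₁ q = τ (+ X q ℤ.- + Y q ℤ.+ + m)
    T₂ q = τ (+ X q ℤ.+ + Y q ℤ.- + m)
    R₁ q = ρ (+ Y q ℤ.- + X q ℤ.+ + m)
    R₂ q = ρ (+ Y q ℤ.+ + X q ℤ.- + m)
    B₁ q = β (+ X q ℤ.- + Y q ℤ.+ + 0)
    B₂ q = β (+ X q ℤ.+ + Y q ℤ.- + 0)

    ∑-+₃ : ∀ f g h → ∑ qs (λ q → f q + g q + h q) ≡ ∑ qs f + ∑ qs g + ∑ qs h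
    ∑-+₃ f g h = trans (∑-+ qs (λ q → f q + g q) h) (cong₂ _+_ (∑-+ qs f g) refl)

    regroup : ∀ u v w x y z → (u + v + w) + (x + y + z) ≡ (u + x) + (v + y) + (w + z)
    regroup = ℕ-Solver.solve-∀

    regroup′ : ∀ u v w x y z → (u + v) + (w + x) + (y + z) ≡ (u + w + y) + (v + x + z)
    regroup′ = ℕ-Solver.solve-∀

    interchange : ∀ u v w → (u + w) + (v + w) ≡ (u + v) + (w + w)
    interchange = ℕ-Solver.solve-∀

    d-unique : Unique (map d qs)
    d-unique = unique-map d-inj unique

    e-unique : Unique (map e qs)
    e-unique = unique-map
      (λ p∈qs q∈qs eq → e-inj p∈qs q∈qs (ℤ-Group.∙-cancelʳ (ℤ.- + m) _ _ eq)) unique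

    τ-in : ∀ {k} → k ≤ m → τ (+ k) ≡ k
    τ-in = window-in (λ k → k)

    β-in : ∀ {k} → k ≤ m → β (+ k) ≡ m
    β-in = window-in (const m)

    m-k : ∀ {k} → k ≤ m → + m ℤ.- + k ≡ + (m ∸ k)
    m-k {k} k≤m = trans (ℤ.m-n≡m⊖n m k) (ℤ.⊖-≥ k≤m)

    ρ-in : ∀ {k} → k ≤ m → ρ (+ k) ≡ m ∸ k
    ρ-in {k} k≤m = trans (cong τ (m-k k≤m)) (τ-in (ℕ.m∸n≤m m k))

    top : ∑ qs X + X t ≤ ∑ qs T₁ + ∑ qs T₂
    top = ≤-trans
      (ℕ.+-mono-≤ (∑-mono qs λ q∈qs → ≤-reflexive (sym (τ-in (X≤W q∈qs))))
                  (≤-reflexive (sym (τ-in (X≤W t∈qs)))))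
      (row-inequality queens t∈qs (cong +_ Yt≡H) τ)

    right : ∑ qs (λ q → m ∸ Y q) + (m ∸ Y r) ≤ ∑ qs R₁ + ∑ qs R₂
    right = ≤-trans
      (ℕ.+-mono-≤ (∑-mono qs λ q∈qs → ≤-reflexive (sym (ρ-in (Y≤H q∈qs))))
                  (≤-reflexive (sym (ρ-in (Y≤H r∈qs)))))
      (row-inequality (transpose queens) r∈qs (cong +_ Xr≡W) ρ)

    bottom : ∑ qs (const m) + m ≤ ∑ qs B₁ + ∑ qs B₂
    bottom = ≤-trans
      (ℕ.+-mono-≤ (∑-mono qs λ q∈qs → ≤-reflexive (sym (β-in (X≤W q∈qs))))
                  (≤-reflexive (sym (β-in (X≤W b∈qs)))))
      (row-inequality queens b∈qs (cong +_ Yb≡0) β)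

    τ-≤ : ∀ k → τ (+ k) ≤ k
    τ-≤ = window-≤ (λ k → k)

    β-≤ : ∀ z → β z ≤ m
    β-≤ (+ k)    = window-≤ (const m) k
    β-≤ -[1+ k ] = z≤n

    -- A sum diagonal meets the top and the right side at the same coordinate `z`, where the weights
    -- `z` and `m - z` add up to `m`.
    τ+ρ≤β : ∀ z → τ z + ρ z ≤ β z
    τ+ρ≤β -[1+ k ] = ≤-reflexive (window-out (λ k → k) (ℕ.m<m+n m (s≤s z≤n)))
    τ+ρ≤β (+ k) with ℕ.≤-<-connex k m
    ... | inj₁ k≤m = ≤-reflexive (trans (cong₂ _+_ (τ-in k≤m) (ρ-in k≤m))
                       (trans (ℕ.m+[n∸m]≡n k≤m) (sym (β-in k≤m))))
    ... | inj₂ m<k = ≤-trans (≤-reflexive (cong₂ _+_ (window-out (λ k → k) m<k) (ρ-out m<k))) z≤n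
      where
      ρ-out : ∀ {k} → m < k → ρ (+ k) ≡ 0
      ρ-out {k} m<k rewrite ℤ.m-n≡m⊖n m k | ℤ.⊖-< m<k with k ∸ m | ℕ.m<n⇒0<n∸m m<k
      ... | suc _ | _ = refl

    -- For negative `z` only the top side is met, with weight at most `k`. For positive `z` the top
    -- is missed, while right and bottom give at most `z + m`, which is `k`. For `z` equal to 0 the
    -- top and the bottom give `m` each, which accounts for the spike.
    d-balance : ∀ z {k} → z ℤ.+ + m ≡ + k → τ (+ k) + τ z + β z ≤ k + spike m z
    d-balance (+ zero)  refl = begin
      τ (+ m) + τ (+ 0) + β (+ 0)  ≤⟨ ℕ.+-mono-≤ (ℕ.+-mono-≤ (τ-≤ m) (τ-≤ 0)) (β-≤ (+ 0)) ⟩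
      (m + 0) + m                  ≡⟨ cong (_+ m) (ℕ.+-identityʳ m) ⟩
      m + m                        ∎
    d-balance (+ suc j) refl = begin
      τ (+ (suc j + m)) + τ (+ suc j) + β (+ suc j)
        ≤⟨ ℕ.+-mono-≤ (ℕ.+-mono-≤ (≤-reflexive (window-out (λ k → k) (ℕ.m<n+m m (s≤s z≤n))))
                                  (τ-≤ (suc j))) (β-≤ (+ suc j)) ⟩
      suc j + m        ≡⟨ ℕ.+-identityʳ (suc j + m) ⟨
      (suc j + m) + 0  ∎
    d-balance -[1+ j ]  {k} _ =
      ≤-trans (≤-reflexive (ℕ.+-identityʳ (τ (+ k) + 0))) (ℕ.+-monoˡ-≤ 0 (τ-≤ k))

    -- The coordinates `z` and `z + m` both lie between 0 and `m` only if `z` is 0, that is, on the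
    -- main antidiagonal.
    e-balance : ∀ z → β z + β (z ℤ.+ + m) ≤ m + spike m z
    e-balance (+ zero)   = ℕ.+-mono-≤ (β-≤ (+ 0)) (β-≤ (+ m))
    e-balance (+ suc k)  =
      ℕ.+-mono-≤ (β-≤ (+ suc k)) (≤-reflexive (window-out (const m) (ℕ.m<n+m m (s≤s z≤n))))
    e-balance -[1+ k ]   = ≤-trans (β-≤ (-[1+ k ] ℤ.+ + m)) (ℕ.m≤m+n m 0)

    d-hits : ∀ {q} → q ∈ₗ qs → T₁ q + R₁ q + B₁ q ≤ C q + spike m (d q)
    d-hits {q} q∈qs = begin
      T₁ q + R₁ q + B₁ q
        ≡⟨ cong₂ _+_ (cong₂ _+_ (cong τ d+m≡C) (cong τ (mirror (+ X q) (+ Y q) (+ m))))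
                     (cong β (ℤ.+-identityʳ (d q))) ⟩
      τ (+ C q) + τ (d q) + β (d q)  ≤⟨ d-balance (d q) d+m≡C ⟩
      C q + spike m (d q)            ∎
      where
      assoc : ∀ x y z → x ℤ.- y ℤ.+ z ≡ x ℤ.+ (z ℤ.- y)
      assoc = ℤ-Solver.solve-∀

      mirror : ∀ x y z → z ℤ.- (y ℤ.- x ℤ.+ z) ≡ x ℤ.- y
      mirror = ℤ-Solver.solve-∀

      d+m≡C : d q ℤ.+ + m ≡ + C q
      d+m≡C = trans (assoc (+ X q) (+ Y q) (+ m)) (cong (λ z → + X q ℤ.+ z) (m-k (Y≤H q∈qs)))

    e-hits : ∀ q → T₂ q + R₂ q + B₂ q ≤ m + spike m (e q)
    e-hits q = begin
      T₂ q + R₂ q + B₂ q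
        ≡⟨ cong₂ _+_ (cong (λ z → T₂ q + ρ (z ℤ.- + m)) (ℤ.+-comm (+ Y q) (+ X q)))
                     (cong β (cancel (+ X q ℤ.+ + Y q) (+ m))) ⟩
      τ (e q) + ρ (e q) + β (e q ℤ.+ + m)  ≤⟨ ℕ.+-monoˡ-≤ _ (τ+ρ≤β (e q)) ⟩
      β (e q) + β (e q ℤ.+ + m)            ≤⟨ e-balance (e q) ⟩
      m + spike m (e q)                    ∎
      where
      cancel : ∀ a b → a ℤ.- + 0 ≡ a ℤ.- b ℤ.+ b
      cancel = ℤ-Solver.solve-∀

-- Collapse of the box to a single queen.

-- `top≤right` for the box and for its transpose gives `X t ≡ Y r`. Since `Y t` and `X r` both equal
-- `m`, the queens `t` and `r` have the same coordinate sum and so coincide.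
top-in-corner : ∀ {qs : List A} {X Y l r b t m} → Boxed qs X Y l r b t m m → X t ≡ m
top-in-corner {X = X} {Y} {r = r} B = trans (cong X t≡r) Xr≡W
  where
  open Boxed B

  t≡r : _ ≡ r
  t≡r = Crossing.e-inj queens t∈qs r∈qs (cong +_ (trans
    (cong₂ _+_ (ℕ.≤-antisym (top≤right B) (top≤right (Boxed-transpose B))) (trans Yt≡H (sym Xr≡W)))
    (ℕ.+-comm (Y r) (X r))))

boxed-unique : ∀ {qs : List A} {X Y l r b t W H} → Boxed qs X Y l r b t W H →
  ∀ {p q} → p ∈ₗ qs → q ∈ₗ qs → p ≡ q
boxed-unique {X = X} {t = t} {W} B p∈qs q∈qs
  with refl ← ℕ.≤-antisym (width≤height B) (width≤height (Boxed-transpose B)) =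
  Crossing.x-inj queens p∈qs q∈qs (cong +_ (trans (X≡0 p∈qs) (sym (X≡0 q∈qs))))
  where
  open Boxed B

  -- The top queen lies in the top right corner and, by reflection, in the top left one.
  W≡0 : W ≡ 0
  W≡0 = begin
    W        ≡⟨ top-in-corner (Boxed-reflect B) ⟨
    W ∸ X t  ≡⟨ cong (W ∸_) (top-in-corner B) ⟩
    W ∸ W    ≡⟨ ℕ.n∸n≡0 W ⟩
    0        ∎
    where open ≡-Reasoning

  X≡0 : ∀ {q} → q ∈ₗ _ → X q ≡ 0
  X≡0 q∈qs = ℕ.n≤0⇒n≡0 (≤-trans (X≤W q∈qs) (≤-reflexive W≡0))

crossing-unique : ∀ {qs : List A} {x y} → Crossing qs x y → ∀ {p q} → p ∈ₗ qs → q ∈ₗ qs → p ≡ q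
crossing-unique {A} {qs} {x} {y} K {p} p∈qs = boxed-unique boxed p∈qs
  where
  module _ (f : A → ℤ) where

    -- `p` serves as the default value of the extrema; as it belongs to `qs`, so do they.
    lowest highest : A
    lowest  = Extrema.argmin f p qs
    highest = Extrema.argmax f p qs

    lowest∈qs : lowest ∈ₗ qs
    lowest∈qs = Extrema.argmin-all f {P = _∈ₗ qs} p∈qs (All.tabulate λ q∈qs → q∈qs)

    highest∈qs : highest ∈ₗ qs
    highest∈qs = Extrema.argmax-all f {P = _∈ₗ qs} p∈qs (All.tabulate λ q∈qs → q∈qs)

    offset : A → ℕ
    offset q = ℤ.∣ f q ℤ.- f lowest ∣

    +offset : ∀ {q} → q ∈ₗ qs → + offset q ≡ f q ℤ.- f lowest
    +offset q∈qs = ℤ.0≤i⇒+∣i∣≡i (ℤ.i≤j⇒0≤j-i (All.lookup (Extrema.f[argmin]≤f[xs] {f = f} p qs) q∈qs))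

    offset-lowest : offset lowest ≡ 0
    offset-lowest = cong ℤ.∣_∣ (ℤ.+-inverseʳ (f lowest))

    offset≤ : ∀ {q} → q ∈ₗ qs → offset q ≤ offset highest
    offset≤ {q} q∈qs = ℤ.drop‿+≤+ (begin
      + offset q              ≡⟨ +offset q∈qs ⟩
      f q ℤ.- f lowest        ≤⟨ ℤ.+-monoˡ-≤ (ℤ.- f lowest)
                                   (All.lookup (Extrema.f[xs]≤f[argmax] {f = f} p qs) q∈qs) ⟩
      f highest ℤ.- f lowest  ≡⟨ +offset highest∈qs ⟨
      + offset highest        ∎)
      where open ℤ.≤-Reasoning

  boxed : Boxed qs (offset x) (offset y) (lowest x) (highest x) (lowest y) (highest y)
                (offset x (highest x)) (offset y (highest y))
  boxed = record
    -- `translate` moves the first coordinate only, so the second is moved between two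
    -- transpositions.
    { queens = translate (+offset x) (transpose (translate (+offset y) (transpose K)))
    ; l∈qs = lowest∈qs x ; r∈qs = highest∈qs x ; b∈qs = lowest∈qs y ; t∈qs = highest∈qs y
    ; Xl≡0 = offset-lowest x ; Xr≡W = refl ; Yb≡0 = offset-lowest y ; Yt≡H = refl
    ; X≤W  = offset≤ x ; Y≤H = offset≤ y
    }

-- Odd independent sets of queen graphs.

length-mono-⊆ : ∀ {xs ys : List A} → Unique xs → (∀ {x} → x ∈ₗ xs → x ∈ₗ ys) → length xs ≤ length ys
length-mono-⊆ {xs = xs} {ys} xs! xs⊆ys = begin
  length xs        ≡⟨ ∑-1 xs ⟨
  ∑ xs (const 1)   ≤⟨ ∑-mono-⊆ (const 1) xs! xs⊆ys ⟩
  ∑ ys (const 1)   ≡⟨ ∑-1 ys ⟩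
  length ys        ∎
  where
  open ≤-Reasoning
  ∑-1 : ∀ zs → ∑ zs (const 1) ≡ length zs
  ∑-1 zs = trans (∑-const zs 1) (ℕ.*-identityʳ (length zs))

attacks? : Decidable₂ Attacks
attacks? (a , b) (a′ , b′) =
  a ℤ.≟ a′ ⊎-dec b ℤ.≟ b′ ⊎-dec a ℤ.- a′ ℤ.≟ b ℤ.- b′ ⊎-dec a ℤ.- a′ ℤ.≟ b′ ℤ.- b

hasOddSize-1 : ∀ {P : Pred A 0ℓ} {x} → P x → (∀ {y} → P y → y ≡ x) → HasOddSize P
hasOddSize-1 {x = x} Px unique =
  1 , (x ∷ [] , [] ∷ [] , (λ y → mk⇔ (λ { (here refl) → Px }) (here ∘ unique)) , refl) ,
  λ 2∣1 → contradiction (∣1⇒≡1 2∣1) λ ()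

module _ {B : Pred (ℤ × ℤ) 0ℓ} where

  open Graph (Queen B) using (Vertex; _~_)

  _≟ᵥ_ : DecidableEquality Vertex
  _≟ᵥ_ = Refinement._≟_ (≡-dec ℤ._≟_ ℤ._≟_)

  _~?_ : Decidable₂ _~_
  u ~? v = ¬? (u ≟ᵥ v) ×-dec attacks? (value u) (value v)

module _ {B : Pred (ℤ × ℤ) 0ℓ}
         (rectangular : ∀ {u v} → B u → B v → B (proj₁ u , proj₂ v))
         {S : Pred (Graph.Vertex (Queen B)) 0ℓ} (odd : IsOddIndependent (Queen B) S) where

  open Graph (Queen B) using (Vertex)

  private
    x y : Vertex → ℤ
    x = proj₁ ∘ value
    y = proj₂ ∘ value

    cell : Vertex → Vertex → Vertex
    cell p q = (x p , y q) , Irrelevant.zipWith rectangular (proof p) (proof q)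

    non-attacking : ∀ {p q} → S p → S q → Attacks (value p) (value q) → p ≡ q
    non-attacking {p} {q} p∈S q∈S attack with p ≟ᵥ q
    ... | yes p≡q = p≡q
    ... | no  p≢q = contradiction (p≢q , attack) (proj₁ odd p q p∈S q∈S)

    -- `Attacks` compares displacements, `Crossing` compares the diagonal invariants `x - y` and
    -- `x + y`; this lemma and the next three translate between the two.
    d-attack : ∀ a a′ b b′ → a ℤ.- b ≡ a′ ℤ.- b′ → a ℤ.- a′ ≡ b ℤ.- b′
    d-attack a a′ b b′ eq = trans (lhs a a′ b) (trans (cong (λ z → z ℤ.+ (b ℤ.- a′)) eq) (rhs a′ b b′))
      where
      lhs : ∀ a a′ b → a ℤ.- a′ ≡ (a ℤ.- b) ℤ.+ (b ℤ.- a′)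
      lhs = ℤ-Solver.solve-∀
      rhs : ∀ a′ b b′ → (a′ ℤ.- b′) ℤ.+ (b ℤ.- a′) ≡ b ℤ.- b′
      rhs = ℤ-Solver.solve-∀

    e-attack : ∀ a a′ b b′ → a ℤ.+ b ≡ a′ ℤ.+ b′ → a ℤ.- a′ ≡ b′ ℤ.- b
    e-attack a a′ b b′ eq = trans (lhs a a′ b) (trans (cong (λ z → z ℤ.- (b ℤ.+ a′)) eq) (rhs a′ b b′))
      where
      lhs : ∀ a a′ b → a ℤ.- a′ ≡ (a ℤ.+ b) ℤ.- (b ℤ.+ a′)
      lhs = ℤ-Solver.solve-∀
      rhs : ∀ a′ b b′ → (a′ ℤ.+ b′) ℤ.- (b ℤ.+ a′) ≡ b′ ℤ.- b
      rhs = ℤ-Solver.solve-∀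

    attack-d : ∀ a a′ b b′ → a ℤ.- a′ ≡ b ℤ.- b′ → a′ ℤ.- b′ ≡ a ℤ.- b
    attack-d a a′ b b′ eq = sym (d-attack a b a′ b′ eq)

    attack-e : ∀ a a′ b b′ → a ℤ.- a′ ≡ b′ ℤ.- b → a′ ℤ.+ b′ ≡ a ℤ.+ b
    attack-e a a′ b b′ eq = trans (lhs a′ b b′) (trans (cong (λ z → z ℤ.+ (a′ ℤ.+ b)) (sym eq)) (rhs a a′ b))
      where
      lhs : ∀ a′ b b′ → a′ ℤ.+ b′ ≡ (b′ ℤ.- b) ℤ.+ (a′ ℤ.+ b)
      lhs = ℤ-Solver.solve-∀
      rhs : ∀ a a′ b → (a ℤ.- a′) ℤ.+ (a′ ℤ.+ b) ≡ a ℤ.+ b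
      rhs = ℤ-Solver.solve-∀

    OnDiagonal : Vertex → Vertex → Vertex → Set
    OnDiagonal p q r = x r ℤ.- y r ≡ x p ℤ.- y q ⊎ x r ℤ.+ y r ≡ x p ℤ.+ y q

    -- For distinct `p` and `q`, a queen on the cell would share a column with `p` and a row with
    -- `q`, so the cell is outside `S`. Independence makes `p` its only attacker along the column
    -- and `q` its only one along the row; with no diagonal attacker the count would be 2, which is
    -- even. For `p ≡ q` the cell is `p` itself.
    diagonal-attacker : ∀ {p q} → S p → S q → ∃[ r ] S r × OnDiagonal p q r
    diagonal-attacker {p} {q} p∈S q∈S with p ≟ᵥ q
    ... | yes refl = p , p∈S , inj₁ refl
    ... | no  p≢q  = search (proj₂ odd c c∉S)
      where
      c : Vertex
      c = cell p q

      c∉S : ¬ S c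
      c∉S c∈S = p≢q (non-attacking p∈S q∈S (inj₂ (inj₁ (cong y p≡c))))
        where
        p≡c : p ≡ c
        p≡c = non-attacking p∈S c∈S (inj₁ refl)

      c~ : ∀ {r} → S r → Attacks (value c) (value r) → (N (Queen B) c ∩ S) r
      c~ r∈S attack = ((λ { refl → c∉S r∈S }) , attack) , r∈S

      search : Empty (N (Queen B) c ∩ S) ⊎ HasOddSize (N (Queen B) c ∩ S) →
        ∃[ r ] S r × OnDiagonal p q r
      search (inj₁ empty) = contradiction (c~ p∈S (inj₁ refl)) (empty p)
      search (inj₂ (k , (rs , rs! , rs⇔ , refl) , k-odd))
        with any? (λ r → x r ℤ.- y r ℤ.≟ x p ℤ.- y q ⊎-dec x r ℤ.+ y r ℤ.≟ x p ℤ.+ y q) rs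
      ... | yes found with r , r∈rs , diag ← find found =
        r , proj₂ (Equivalence.to (rs⇔ r) r∈rs) , diag
      ... | no none = contradiction (subst (2 ∣_) (sym k≡2) ∣-refl) k-odd
        where
        rs⊆ : ∀ {r} → r ∈ₗ rs → r ∈ₗ p ∷ q ∷ []
        rs⊆ {r} r∈rs with Equivalence.to (rs⇔ r) r∈rs
        ... | (_ , inj₁ col) , r∈S = here (non-attacking r∈S p∈S (inj₁ (sym col)))
        ... | (_ , inj₂ (inj₁ row)) , r∈S =
          there (here (non-attacking r∈S q∈S (inj₂ (inj₁ (sym row)))))
        ... | (_ , inj₂ (inj₂ (inj₁ eq))) , _ =
          contradiction (lose r∈rs (inj₁ (attack-d (x p) (x r) (y q) (y r) eq))) none
        ... | (_ , inj₂ (inj₂ (inj₂ eq))) , _ =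
          contradiction (lose r∈rs (inj₂ (attack-e (x p) (x r) (y q) (y r) eq))) none

        ⊆rs : ∀ {r} → r ∈ₗ p ∷ q ∷ [] → r ∈ₗ rs
        ⊆rs (here refl)         = Equivalence.from (rs⇔ _) (c~ p∈S (inj₁ refl))
        ⊆rs (there (here refl)) = Equivalence.from (rs⇔ _) (c~ q∈S (inj₂ (inj₁ refl)))

        k≡2 : length rs ≡ 2
        k≡2 = ℕ.≤-antisym (length-mono-⊆ rs! rs⊆) (length-mono-⊆ ((p≢q ∷ []) ∷ [] ∷ []) ⊆rs)

  oddIndependent-unique : Finite S → ∀ {p q} → S p → S q → p ≡ q
  oddIndependent-unique (_ , qs , qs! , qs⇔ , _) p∈S q∈S =
    crossing-unique queens (Equivalence.from (qs⇔ _) p∈S) (Equivalence.from (qs⇔ _) q∈S)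
    where
    to : ∀ {q} → q ∈ₗ qs → S q
    to = Equivalence.to (qs⇔ _)

    queens : Crossing qs x y
    queens = record
      { unique   = qs!
      ; x-inj    = λ p∈ q∈ eq → non-attacking (to p∈) (to q∈) (inj₁ eq)
      ; y-inj    = λ p∈ q∈ eq → non-attacking (to p∈) (to q∈) (inj₂ (inj₁ eq))
      ; d-inj    = λ {p} {q} p∈ q∈ eq → non-attacking (to p∈) (to q∈)
          (inj₂ (inj₂ (inj₁ (d-attack (x p) (x q) (y p) (y q) eq))))
      ; e-inj    = λ {p} {q} p∈ q∈ eq → non-attacking (to p∈) (to q∈)
          (inj₂ (inj₂ (inj₂ (e-attack (x p) (x q) (y p) (y q) eq))))
      ; crossing = λ p∈ q∈ → let r , r∈S , diag = diagonal-attacker (to p∈) (to q∈) in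
          r , Equivalence.from (qs⇔ r) r∈S , diag
      }

  oddIndependent-≤1 : ∀ {k} → HasSize S k → k ≤ 1
  oddIndependent-≤1 ([]         , _   , _   , refl) = z≤n
  oddIndependent-≤1 (_ ∷ []     , _   , _   , refl) = ≤-refl
  oddIndependent-≤1 size@(p ∷ q ∷ _ , (p≢q ∷ _) ∷ _ , qs⇔ , _) = contradiction
    (oddIndependent-unique (_ , size) (Equivalence.to (qs⇔ p) (here refl))
                                      (Equivalence.to (qs⇔ q) (there (here refl)))) p≢q

  -- Excluded middle decides whether `S` is finite; the enumerating list of a finite `S` then tells
  -- the empty case from the singleton.
  oddIndependent-trichotomy : ExcludedMiddle 0ℓ → Empty S ⊎ Singleton S ⊎ Infinite S
  oddIndependent-trichotomy em with em {Finite S}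
  ... | no infinite = inj₂ (inj₂ infinite)
  ... | yes (_ , [] , _ , qs⇔ , _) = inj₁ λ q q∈S → ¬Any[] (Equivalence.from (qs⇔ q) q∈S)
  ... | yes finite@(_ , p ∷ _ , _ , qs⇔ , _) = inj₂ (inj₁
    (p , oddIndependent-unique finite p∈S , λ { refl → p∈S }))
    where
    p∈S : S p
    p∈S = Equivalence.to (qs⇔ p) (here refl)

-- The finite boards: colourings and independence number.

module _ {n : ℕ} where

  open Graph (Queen (square n)) using (Vertex)

  square-rectangular : ∀ {u v} → square n u → square n v → square n (proj₁ u , proj₂ v)
  square-rectangular (a , _) (_ , b) = a , b

  private
    -- The bounds are irrelevant arguments because a vertex stores its board membership
    -- irrelevantly. Coordinates start at 1 and indices at 0.
    index : ∀ a → .(ℤ.1ℤ ℤ.≤ a) → .(a ℤ.≤ + n) → Fin n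
    index (+ zero)  1≤a a≤n = ⊥-elim-irr (ℕ.n≮0 (ℤ.drop‿+≤+ 1≤a))
    index (+ suc k) 1≤a a≤n = fromℕ< {k} (ℤ.drop‿+≤+ a≤n)
    index -[1+ k ]  1≤a a≤n = ⊥-elim-irr (case 1≤a of λ ())

    +index : ∀ a .(1≤a : ℤ.1ℤ ℤ.≤ a) .(a≤n : a ℤ.≤ + n) → + suc (toℕ (index a 1≤a a≤n)) ≡ a
    +index (+ zero)  1≤a a≤n = ⊥-elim-irr (ℕ.n≮0 (ℤ.drop‿+≤+ 1≤a))
    +index (+ suc k) 1≤a a≤n = cong (+_ ∘ suc) (toℕ-fromℕ< (ℤ.drop‿+≤+ a≤n))
    +index -[1+ k ]  1≤a a≤n = ⊥-elim-irr (case 1≤a of λ ())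

    range : ∀ (i : Fin n) → ℤ.1ℤ ℤ.≤ + suc (toℕ i) × + suc (toℕ i) ℤ.≤ + n
    range i = ℤ.+≤+ (s≤s z≤n) , ℤ.+≤+ (toℕ<n i)

    vertex : Fin n × Fin n → Vertex
    vertex (i , j) = (+ suc (toℕ i) , + suc (toℕ j)) , [ (range i , range j) ]

    encode : Vertex → Fin (n * n)
    encode ((a , b) , [ p ]) = combine
      (index a (proj₁ (proj₁ p)) (proj₂ (proj₁ p))) (index b (proj₁ (proj₂ p)) (proj₂ (proj₂ p)))

    decode : Fin (n * n) → Vertex
    decode = vertex ∘ remQuot n

    decode-encode : ∀ v → decode (encode v) ≡ v
    decode-encode v@((a , b) , [ p ]) = trans (cong vertex (remQuot-combine _ _)) (value-injective
      (cong₂ _,_ (+index a (proj₁ (proj₁ p)) (proj₂ (proj₁ p)))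
                 (+index b (proj₁ (proj₂ p)) (proj₂ (proj₂ p)))))

    encode-injective : ∀ {u v} → encode u ≡ encode v → u ≡ v
    encode-injective {u} {v} eq =
      trans (sym (decode-encode u)) (trans (cong decode eq) (decode-encode v))

    vertex-injective : ∀ {i j} → vertex i ≡ vertex j → i ≡ j
    vertex-injective eq = cong₂ _,_
      (toℕ-injective (ℕ.suc-injective (ℤ.+-injective (cong (proj₁ ∘ value) eq))))
      (toℕ-injective (ℕ.suc-injective (ℤ.+-injective (cong (proj₂ ∘ value) eq))))

    decode-injective : ∀ {i j} → decode i ≡ decode j → i ≡ j
    decode-injective {i} {j} eq = trans (sym (combine-remQuot {n} n i))
      (trans (cong (uncurry combine) (vertex-injective eq)) (combine-remQuot {n} n j))

    vertices : List Vertex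
    vertices = map decode (allFin (n * n))

    vertices-unique : Unique vertices
    vertices-unique = Unique.map⁺ decode-injective (Unique.allFin⁺ (n * n))

    ∈vertices : ∀ v → v ∈ₗ vertices
    ∈vertices v = subst (_∈ₗ vertices) (decode-encode v) (∈-map⁺ decode (∈-allFin (encode v)))

  -- Every colour class is an odd independent set: properness gives independence, and the parity
  -- condition covers each vertex that sees the class. Being finite, the class has at most one
  -- vertex.
  coloring-injective : ∀ {k} (φ : Vertex → Fin k) → IsStrongOddColoring (Queen (square n)) φ →
    ∀ {u v} → φ u ≡ φ v → u ≡ v
  coloring-injective φ (proper , odd) {u} {v} φu≡φv =
    oddIndependent-unique square-rectangular odd-class finite φu≡φv refl
    where
    G : Graph
    G = Queen (square n)

    S : Pred Vertex 0ℓ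
    S = ColorClass G φ (φ v)

    S? : Decidable₁ S
    S? w = φ w Fin.≟ φ v

    odd-class : IsOddIndependent G S
    odd-class = (λ p q p∈S q∈S p~q → proper p q p~q (trans p∈S (sym q∈S))) , λ w _ → neighbours w
      where
      neighbours : ∀ w → Empty (N G w ∩ S) ⊎ HasOddSize (N G w ∩ S)
      neighbours w with any? (λ q → (w ~? q) ×-dec S? q) vertices
      ... | yes some = inj₂ (odd w (φ v) (satisfied some))
      ... | no  none = inj₁ λ q q∈ → none (lose (∈vertices q) q∈)

    finite : Finite S
    finite = _ , filter S? vertices , Unique.filter⁺ S? vertices-unique ,
      (λ q → mk⇔ (proj₂ ∘ ∈-filter⁻ S? {xs = vertices}) (∈-filter⁺ S? (∈vertices q))) , refl

  -- Giving every vertex its own colour makes each colour occur at most once in a neighbourhood.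
  -- Conversely any strong odd colouring is injective and so uses at least `n * n` colours.
  strongOddChromaticNumber : StrongOddChromaticNumber (Queen (square n)) (n * n)
  strongOddChromaticNumber =
    (encode , (λ u v u~v eq → proj₁ u~v (encode-injective eq)) , odd) ,
    λ m (φ , φ-odd) → injective⇒≤ {f = φ ∘ decode} (decode-injective ∘ coloring-injective φ φ-odd)
    where
    odd : ∀ v c → Satisfiable (N (Queen (square n)) v ∩ ColorClass (Queen (square n)) encode c) →
      HasOddSize (N (Queen (square n)) v ∩ ColorClass (Queen (square n)) encode c)
    odd v c (u , v~u , refl) = hasOddSize-1 (v~u , refl) (encode-injective ∘ proj₂)

  -- The corner `(1 , 1)` exists because `1 ≤ n`, and each of its neighbours sees exactly one vertex
  -- of the singleton.
  oddIndependenceNumber : 1 ≤ n → OddIndependenceNumber (Queen (square n)) 1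
  oddIndependenceNumber 1≤n =
    (｛ o ｝ , odd , o ∷ [] , [] ∷ [] , (λ v → mk⇔ (λ { (here eq) → sym eq ; (there ()) }) (here ∘ sym)) ,
      refl) ,
    λ { m (S , S-odd , size) → oddIndependent-≤1 square-rectangular S-odd size }
    where
    o : Vertex
    o = (+ 1 , + 1) , [ ((ℤ.≤-refl , ℤ.+≤+ 1≤n) , (ℤ.≤-refl , ℤ.+≤+ 1≤n)) ]

    odd : IsOddIndependent (Queen (square n)) ｛ o ｝
    odd = (λ { u v refl refl (u≢u , _) → u≢u refl }) , neighbours
      where
      neighbours : ∀ v → v ∉ ｛ o ｝ →
        Empty (N (Queen (square n)) v ∩ ｛ o ｝) ⊎ HasOddSize (N (Queen (square n)) v ∩ ｛ o ｝)
      neighbours v _ with v ~? o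
      ... | yes v~o = inj₂ (hasOddSize-1 (v~o , refl) (sym ∘ proj₂))
      ... | no  v≁o = inj₁ λ { _ (v~o , refl) → v≁o v~o }

corollary7 : (∀ n → 1 ≤ n → OddIndependenceNumber (Queen (square n)) 1) ×
    (∀ n → 1 ≤ n → StrongOddChromaticNumber (Queen (square n)) (n ^ 2)) ×
    (ExcludedMiddle 0ℓ →
    (∀ (S : Pred (Graph.Vertex (Queen ℕ×ℕ)) 0ℓ) → IsOddIndependent (Queen ℕ×ℕ) S →
    Empty S ⊎ Singleton S ⊎ Infinite S) ×
    (∀ (S : Pred (Graph.Vertex (Queen ℤ×ℤ)) 0ℓ) → IsOddIndependent (Queen ℤ×ℤ) S →
    Empty S ⊎ Singleton S ⊎ Infinite S))
corollary7 =
  (λ n → oddIndependenceNumber) ,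
  -- `n ^ 2` unfolds to `n * (n * 1)`.
  (λ n _ → subst (StrongOddChromaticNumber (Queen (square n))) (cong (n *_) (sym (ℕ.*-identityʳ n)))
             strongOddChromaticNumber) ,
  λ em → (λ S odd → oddIndependent-trichotomy (λ (1≤a , _) (_ , 1≤b) → 1≤a , 1≤b) odd em) ,
         (λ S odd → oddIndependent-trichotomy (λ _ _ → _) odd em)
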